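{- For every $n\ge1$, $|\operatorname{Sort}_n(\operatorname{SC}_{123})|=M_{n+1}-M_n$.
   Context: $S_n$ is the set of permutations of $[n]$ in one-line notation. Two sequences of distinct integers have the same relative order if replacing the $i$th smallest entry of each by $i$ yields the same word; a permutation contains $\sigma$ classically (resp. consecutively) if some subsequence (resp. consecutive subsequence) has the same relative order as $\sigma$, and avoids it otherwise. $\operatorname{SC}_{123}:S_n\to S_n$ sends a permutation through a stack: at each step, if there is a next input entry and placing it on top of the stack would make the stack contents, read top to bottom, avoid $123$ consecutively, push it; otherwise pop the top entry to the end of the output; stop when the output has length $n$. $\operatorname{Sort}_n(\operatorname{SC}_{123})$ is the set of $\pi\in S_n$ with $\operatorname{SC}_{123}(\pi)$ avoiding $231$ classically. Motzkin numbers: $M_0=M_1=1$ and $M_n=M_{n-1}+\sum_{i=0}^{n-2}M_iM_{n-2-i}$ for $n\ge2$. -}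

module Defs where

open import Data.Nat using (ℕ; zero; suc; _+_; _*_; _<ᵇ_)
open import Data.Bool using (Bool; true; false; _∧_; _∨_; not; T)
open import Data.List using (List; []; _∷_; map; concatMap; upTo; length; filter; zipWith; reverse)
open import Data.Bool.ListAction using (any)
open import Data.Nat.ListAction using (sum)
open import Relation.Nullary.Decidable using (T?)

insertions : ℕ → List ℕ → List (List ℕ)
insertions x [] = (x ∷ []) ∷ []
insertions x (y ∷ ys) = (x ∷ y ∷ ys) ∷ map (y ∷_) (insertions x ys)

perms : List ℕ → List (List ℕ)
perms [] = [] ∷ []
perms (x ∷ xs) = concatMap (insertions x) (perms xs)

S : ℕ → List (List ℕ)
S n = perms (map suc (upTo n))

contains123consec : List ℕ → Bool
contains123consec (a ∷ b ∷ c ∷ r) = ((a <ᵇ b) ∧ (b <ᵇ c)) ∨ contains123consec (b ∷ c ∷ r)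
contains123consec _ = false

private
  has231from : ℕ → List ℕ → Bool
  has231from a [] = false
  has231from a (b ∷ r) = ((a <ᵇ b) ∧ any (λ c → c <ᵇ a) r) ∨ has231from a r

contains231 : List ℕ → Bool
contains231 [] = false
contains231 (a ∷ r) = has231from a r ∨ contains231 r

-- The stack machine SC_123.  State: remaining input, stack (head = top),
-- output (stored reversed).  `fuel` bounds the number of steps; 2n steps
-- always suffice (each entry is pushed once and popped once).
scRun : ℕ → ℕ → List ℕ → List ℕ → List ℕ → List ℕ
scRun zero n inp stk outRev = reverse outRev
scRun (suc fuel) n inp stk outRev with length outRev Data.Nat.≡ᵇ n
... | true = reverse outRev
... | false = step inp stk
  where
  pop : List ℕ → List ℕ
  pop [] = reverse outRev
  pop (s ∷ ss) = scRun fuel n inp ss (s ∷ outRev)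
  step : List ℕ → List ℕ → List ℕ
  step [] stk = pop stk
  step (x ∷ xs) stk with contains123consec (x ∷ stk)
  ... | false = scRun fuel n xs (x ∷ stk) outRev
  ... | true = pop stk

SC123 : List ℕ → List ℕ
SC123 π = scRun (2 * length π) (length π) π [] []

Sort : ℕ → List (List ℕ)
Sort n = filter (λ π → T? (not (contains231 (SC123 π)))) (S n)

-- Motzkin numbers: motzkinsRev n = [M_n, M_{n-1}, …, M_0]
motzkinsRev : ℕ → List ℕ
motzkinsRev zero = 1 ∷ []
motzkinsRev (suc zero) = 1 ∷ 1 ∷ []
motzkinsRev (suc (suc n)) with motzkinsRev (suc n)
... | [] = []
... | m ∷ ms = (m + sum (zipWith _*_ ms (reverse ms))) ∷ m ∷ ms

M : ℕ → ℕ
M n with motzkinsRev n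
... | [] = 0
... | m ∷ _ = m

{-# OPTIONS --safe #-}

-- SC₁₂₃ pops an entry before the input is exhausted exactly when it is a double descent, i.e. the
-- middle of a consecutive a > d > b, so SC₁₂₃(π) lists the double descents of π in order and then
-- the other entries in reverse.  Write π = A m B with m the maximum.  A word X m Y with m its
-- maximum avoids 231 iff X and Y avoid 231 and X ≤ Y.  Hence π is sortable iff B < A, A has no
-- double descent and its reverse avoids 231, and B is sortable when regarded as preceded by a
-- larger entry.  By similar decompositions both the words A and the words B are counted by M, so
-- there are Σ_{i+j=n-1} M_i M_j = M_{n+1} - M_n sortable permutations.
module Submission where

open import Defs
open import Data.Nat
open import Data.Nat.Properties
open import Data.Nat.ListAction using (sum)
open import Data.Nat.Tactic.RingSolver using (solve-∀)
open import Data.Bool using (Bool; true; false; _∧_; _∨_; not; T; if_then_else_)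
open import Data.Bool.Properties
  using (T-≡; T-not-≡; ∧-conicalˡ; ∧-conicalʳ; ∨-conicalˡ; ∨-conicalʳ)
open import Data.Bool.ListAction using (any)
open import Data.Empty using (⊥; ⊥-elim)
open import Data.List
  using (List; []; _∷_; _++_; [_]; length; reverse; map; concatMap; zipWith;
         cartesianProductWith; upTo; applyUpTo; applyDownFrom)
open import Data.List.Properties
open import Data.List.Membership.Propositional using (_∈_; _∉_)
open import Data.List.Membership.Propositional.Properties
open import Data.List.Membership.Propositional.Properties.WithK using (unique∧set⇒bag)
open import Data.List.Relation.Binary.BagAndSetEquality using (∼bag⇒↭)
open import Data.List.Relation.Binary.Permutation.Propositional
  using (_↭_; prep; ↭-refl; ↭-sym; ↭-trans; ↭-reflexive; module PermutationReasoning)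
open import Data.List.Relation.Binary.Permutation.Propositional.Properties
  using (∈-resp-↭; ↭-reverse; shift; drop-mid; ↭-empty-inv; ↭-length)
  renaming (++⁺ to ↭-++⁺)
open import Data.List.Relation.Unary.All as All using (All; []; _∷_)
open import Data.List.Relation.Unary.All.Properties using (++⁺; ++⁻ˡ)
open import Data.List.Relation.Unary.AllPairs using ([]; _∷_)
open import Data.List.Relation.Unary.Any using (here; there)
open import Data.List.Relation.Unary.Unique.Propositional using (Unique)
open import Data.List.Relation.Unary.Unique.Propositional.Properties
  using (map⁺; filter⁺; upTo⁺; Unique[x∷xs]⇒x∉xs) renaming (++⁺ to unique-++⁺)
open import Data.Product using (Σ; ∃; ∃₂; _×_; _,_; proj₁; proj₂)
open import Data.Sum using (inj₁; inj₂)
open import Data.Unit using (⊤; tt)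
open import Function using (_∘_)
open import Function.Bundles using (_⇔_; mk⇔; Equivalence)
open import Function.Construct.Composition using (_⇔-∘_)
open import Relation.Nullary using (¬_)
open import Relation.Nullary.Decidable using (T?)
open import Relation.Binary.PropositionalEquality hiding ([_])

-- Avoidance of 231 as a proposition

Avoids231From : ℕ → List ℕ → Set
Avoids231From a []      = ⊤
Avoids231From a (b ∷ r) = (a < b → All (a ≤_) r) × Avoids231From a r

Avoids231 : List ℕ → Set
Avoids231 []      = ⊤
Avoids231 (a ∷ r) = Avoids231From a r × Avoids231 r

-- `has231from` is private in Defs; unification recovers it from the unfolding of `contains231`.
contains231-unfolding : Σ (ℕ → List ℕ → Bool) λ h →
  (∀ a b r → contains231 (a ∷ b ∷ r) ≡
     (((a <ᵇ b) ∧ any (λ c → c <ᵇ a) r) ∨ h a r) ∨ contains231 (b ∷ r)) ×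
  (∀ a → h a [] ≡ false) ×
  (∀ a b r → h a (b ∷ r) ≡ ((a <ᵇ b) ∧ any (λ c → c <ᵇ a) r) ∨ h a r) ×
  (∀ a r → contains231 (a ∷ r) ≡ h a r ∨ contains231 r)
contains231-unfolding =
  _ , (λ _ _ _ → refl) , (λ _ → refl) , (λ _ _ _ → refl) , (λ _ _ → refl)

<⇒<ᵇ≡true : ∀ {m n} → m < n → (m <ᵇ n) ≡ true
<⇒<ᵇ≡true m<n = Equivalence.to T-≡ (<⇒<ᵇ m<n)

<ᵇ⇒<′ : ∀ m n → (m <ᵇ n) ≡ true → m < n
<ᵇ⇒<′ m n eq = <ᵇ⇒< m n (subst T (sym eq) tt)

<ᵇ-false⇒≥ : ∀ m n → (m <ᵇ n) ≡ false → n ≤ m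
<ᵇ-false⇒≥ m n eq = ≮⇒≥ (λ m<n → subst T eq (<⇒<ᵇ m<n))

any<≡false⇒All≤ : ∀ a r → any (λ c → c <ᵇ a) r ≡ false → All (a ≤_) r
any<≡false⇒All≤ a [] _ = []
any<≡false⇒All≤ a (c ∷ r) eq with c <ᵇ a in c≮a
... | false = <ᵇ-false⇒≥ c a c≮a ∷ any<≡false⇒All≤ a r eq

All≤⇒any<≡false : ∀ a r → All (a ≤_) r → any (λ c → c <ᵇ a) r ≡ false
All≤⇒any<≡false a [] [] = refl
All≤⇒any<≡false a (c ∷ r) (a≤c ∷ a≤r) with c <ᵇ a in c<a
... | true  = ⊥-elim (<⇒≱ (<ᵇ⇒<′ c a c<a) a≤c)
... | false = All≤⇒any<≡false a r a≤r

-- `Avoids231From` asks for `a ≤ c`, the exact negation of the test `c <ᵇ a`, so the equivalence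
-- holds for every word, repeated entries included.
contains231≡false⇔ : ∀ w → contains231 w ≡ false ⇔ Avoids231 w
contains231≡false⇔ w = mk⇔ (to w) (from w)
  where
  h : ℕ → List ℕ → Bool
  h = proj₁ contains231-unfolding

  toFrom : ∀ a r → h a r ≡ false → Avoids231From a r
  toFrom a []      _  = tt
  toFrom a (b ∷ r) eq = first , toFrom a r (∨-conicalʳ ((a <ᵇ b) ∧ smaller) _ eq)
    where
    smaller = any (λ c → c <ᵇ a) r
    first : a < b → All (a ≤_) r
    first a<b = any<≡false⇒All≤ a r (subst (λ t → t ∧ smaller ≡ false) (<⇒<ᵇ≡true a<b)
      (∨-conicalˡ ((a <ᵇ b) ∧ smaller) _ eq))

  to : ∀ w → contains231 w ≡ false → Avoids231 w
  to []      _  = tt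
  to (a ∷ r) eq = toFrom a r (∨-conicalˡ (h a r) _ eq) , to r (∨-conicalʳ (h a r) _ eq)

  fromFrom : ∀ a r → Avoids231From a r → h a r ≡ false
  fromFrom a []      _ = refl
  fromFrom a (b ∷ r) (p , q) rewrite fromFrom a r q with a <ᵇ b in a<b
  ... | false = refl
  ... | true  rewrite All≤⇒any<≡false a r (p (<ᵇ⇒<′ a b a<b)) = refl

  from : ∀ w → Avoids231 w → contains231 w ≡ false
  from []      _ = refl
  from (a ∷ r) (p , q) rewrite fromFrom a r p = from r q

-- Closed form of the output of the stack machine

consIf : Bool → ℕ → List ℕ → List ℕ
consIf true  x w = x ∷ w
consIf false x w = w

-- The flag tells whether the word is preceded by a larger entry.
doubleDescents : Bool → List ℕ → List ℕ
doubleDescents c (x ∷ y ∷ r) =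
  consIf (c ∧ (y <ᵇ x)) x (doubleDescents (y <ᵇ x) (y ∷ r))
doubleDescents c _ = []

others : Bool → List ℕ → List ℕ
others c (x ∷ y ∷ r) = consIf (not (c ∧ (y <ᵇ x))) x (others (y <ᵇ x) (y ∷ r))
others c w = w

output : Bool → List ℕ → List ℕ
output c w = doubleDescents c w ++ reverse (others c w)

-- Shows that the halting test fails as long as the input or the stack holds an entry.
≡ᵇ-+-suc : ∀ n m → (n ≡ᵇ (n + suc m)) ≡ false
≡ᵇ-+-suc zero    m = refl
≡ᵇ-+-suc (suc n) m = ≡ᵇ-+-suc n m

scRun-drain : ∀ f n x stk out → (length out ≡ᵇ n) ≡ false →
  scRun (suc f) n [] (x ∷ stk) out ≡ scRun f n [] stk (x ∷ out)
scRun-drain f n x stk out eq rewrite eq = refl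

scRun-push : ∀ f n x inp stk out → (length out ≡ᵇ n) ≡ false →
  contains123consec (x ∷ stk) ≡ false →
  scRun (suc f) n (x ∷ inp) stk out ≡ scRun f n inp (x ∷ stk) out
scRun-push f n x inp stk out eq eq′ rewrite eq | eq′ = refl

scRun-pop : ∀ f n x inp y stk out → (length out ≡ᵇ n) ≡ false →
  contains123consec (x ∷ y ∷ stk) ≡ true →
  scRun (suc f) n (x ∷ inp) (y ∷ stk) out ≡ scRun f n (x ∷ inp) stk (y ∷ out)
scRun-pop f n x inp y stk out eq eq′ rewrite eq | eq′ = refl

-- Supplies the flag of `output` during a run: an entry at the bottom of the stack counts as
-- preceded by nothing larger.
belowHead : ℕ → List ℕ → Bool
belowHead x []      = false
belowHead x (y ∷ _) = x <ᵇ y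

scRun-empty : ∀ stk out →
  scRun (length stk) (length out + length stk) [] stk out ≡ reverse out ++ stk
scRun-empty [] out = sym (++-identityʳ _)
scRun-empty (x ∷ stk) out = begin
  scRun (suc (length stk)) (length out + suc (length stk)) [] (x ∷ stk) out
    ≡⟨ scRun-drain (length stk) _ x stk out (≡ᵇ-+-suc (length out) _) ⟩
  scRun (length stk) (length out + suc (length stk)) [] stk (x ∷ out)
    ≡⟨ cong (λ n → scRun (length stk) n [] stk (x ∷ out)) (+-suc (length out) _) ⟩
  scRun (length stk) (suc (length out) + length stk) [] stk (x ∷ out)
    ≡⟨ scRun-empty stk (x ∷ out) ⟩
  reverse (x ∷ out) ++ stk
    ≡⟨ cong (_++ stk) (unfold-reverse x out) ⟩
  (reverse out ++ [ x ]) ++ stk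
    ≡⟨ ++-assoc (reverse out) [ x ] stk ⟩
  reverse out ++ x ∷ stk ∎
  where open ≡-Reasoning

-- From `x < z` and avoidance, `z` is not smaller than the entry directly under it, so no 123 has
-- `z` in the middle, whatever lies on top. Hence after a single pop the next input entry can be
-- pushed.
contains123consec-replace-head : ∀ {x y} z stk → y < x → (x <ᵇ z) ≡ true →
  contains123consec (x ∷ z ∷ stk) ≡ false → contains123consec (y ∷ z ∷ stk) ≡ false
contains123consec-replace-head z [] _ _ _ = refl
contains123consec-replace-head {x} {y} z (w ∷ stk) _ x<z eq
  rewrite x<z with z <ᵇ w
... | false with y <ᵇ z
...   | true  = eq
...   | false = eq

contains123consec-∷ : ∀ {y x} stk → contains123consec (x ∷ stk) ≡ false →
  contains123consec (y ∷ x ∷ stk) ≡ belowHead x stk ∧ (y <ᵇ x)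
contains123consec-∷ [] _ = refl
contains123consec-∷ {y} {x} (z ∷ stk) eq rewrite eq
  with x <ᵇ z | y <ᵇ x
... | true  | true  = refl
... | true  | false = refl
... | false | true  = refl
... | false | false = refl

-- Induction on the input. The top `x` stays undecided until the next entry `y` arrives, so it
-- counts as the first letter of the remaining word, with the flag comparing it to the entry under
-- it. If `y` is pushed at once, `x` leaves only after all that follows; otherwise `x` is popped and
-- then `y` is pushed. The fuel is the exact number of steps left: two per input entry and one per
-- stack entry.
scRun-spec : ∀ inp x stk out f n →
  f ≡ suc (length stk) + 2 * length inp →
  n ≡ length out + suc (length inp + length stk) →
  contains123consec (x ∷ stk) ≡ false →
  scRun f n inp (x ∷ stk) out ≡ reverse out ++ output (belowHead x stk) (x ∷ inp) ++ stk
scRun-spec [] x stk out _ _ refl refl _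
  rewrite +-identityʳ (length stk) = scRun-empty (x ∷ stk) out
scRun-spec (y ∷ inp) x stk out f n f≡ n≡ ok
  with belowHead x stk ∧ (y <ᵇ x) in c | contains123consec-∷ {y} stk ok
scRun-spec (y ∷ inp) x stk out (suc f) n f≡ n≡ ok | false | push = begin
  scRun (suc f) n (y ∷ inp) (x ∷ stk) out
    ≡⟨ scRun-push f n y inp (x ∷ stk) out
         (trans (cong (length out ≡ᵇ_) n≡) (≡ᵇ-+-suc (length out) _)) push ⟩
  scRun f n inp (y ∷ x ∷ stk) out
    ≡⟨ scRun-spec inp y (x ∷ stk) out f n
         (suc-injective (trans f≡ (lemma (length inp) (length stk))))
         (trans n≡ (cong (λ k → length out + suc k) (sym (+-suc (length inp) _)))) push ⟩
  reverse out ++ output c′ (y ∷ inp) ++ x ∷ stk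
    ≡⟨ cong (reverse out ++_) (lemma₂ (doubleDescents c′ (y ∷ inp)) (others c′ (y ∷ inp))) ⟩
  reverse out ++ (doubleDescents c′ (y ∷ inp) ++ reverse (x ∷ others c′ (y ∷ inp))) ++ stk ∎
  where
  open ≡-Reasoning
  c′ = y <ᵇ x
  lemma : ∀ a b → suc b + 2 * suc a ≡ suc (suc (suc b) + 2 * a)
  lemma = solve-∀
  lemma₂ : ∀ d r → (d ++ reverse r) ++ x ∷ stk ≡ (d ++ reverse (x ∷ r)) ++ stk
  lemma₂ d r rewrite unfold-reverse x r | sym (++-assoc d (reverse r) [ x ])
    = sym (++-assoc (d ++ reverse r) [ x ] stk)
scRun-spec (y ∷ inp) x (z ∷ stk) out (suc zero) n () n≡ ok | true | pop
scRun-spec (y ∷ inp) x (z ∷ stk) out (suc (suc f)) n f≡ n≡ ok | true | pop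
  = begin
  scRun (suc (suc f)) n (y ∷ inp) (x ∷ z ∷ stk) out
    ≡⟨ scRun-pop (suc f) n y inp x (z ∷ stk) out
         (trans (cong (length out ≡ᵇ_) n≡) (≡ᵇ-+-suc (length out) _)) pop ⟩
  scRun (suc f) n (y ∷ inp) (z ∷ stk) (x ∷ out)
    ≡⟨ scRun-push f n y inp (z ∷ stk) (x ∷ out)
         (trans (cong (suc (length out) ≡ᵇ_) n≡′) (≡ᵇ-+-suc (length out) _)) push ⟩
  scRun f n inp (y ∷ z ∷ stk) (x ∷ out)
    ≡⟨ scRun-spec inp y (z ∷ stk) (x ∷ out) f n
         (suc-injective (suc-injective (trans f≡ (lemma (length inp) (length stk))))) n≡′ push ⟩
  reverse (x ∷ out) ++ output (y <ᵇ z) (y ∷ inp) ++ z ∷ stk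
    -- In the word `y` follows `x`, while on the stack it lies on `z`; both flags are true because
    -- `y < x < z`.
    ≡⟨ cong (λ c → reverse (x ∷ out) ++ output c (y ∷ inp) ++ z ∷ stk) (trans y<z (sym y<x)) ⟩
  reverse (x ∷ out) ++ output (y <ᵇ x) (y ∷ inp) ++ z ∷ stk
    ≡⟨ cong (_++ (output (y <ᵇ x) (y ∷ inp) ++ z ∷ stk)) (unfold-reverse x out) ⟩
  (reverse out ++ [ x ]) ++ output (y <ᵇ x) (y ∷ inp) ++ z ∷ stk
    ≡⟨ ++-assoc (reverse out) [ x ] _ ⟩
  reverse out ++ x ∷ output (y <ᵇ x) (y ∷ inp) ++ z ∷ stk ∎
  where
  open ≡-Reasoning
  x<z = ∧-conicalˡ (x <ᵇ z) _ c
  y<x = ∧-conicalʳ (x <ᵇ z) _ c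
  y<z : (y <ᵇ z) ≡ true
  y<z = <⇒<ᵇ≡true (<-trans (<ᵇ⇒<′ y x y<x) (<ᵇ⇒<′ x z x<z))
  push : contains123consec (y ∷ z ∷ stk) ≡ false
  push = contains123consec-replace-head z stk (<ᵇ⇒<′ y x y<x) x<z ok
  n≡′ : n ≡ suc (length out + suc (length inp + suc (length stk)))
  n≡′ = trans n≡ (+-suc (length out) _)
  lemma : ∀ a b → suc (suc b) + 2 * suc a ≡ suc (suc (suc (suc b) + 2 * a))
  lemma = solve-∀

SC123≡output : ∀ π → SC123 π ≡ output false π
SC123≡output []      = refl
SC123≡output (x ∷ π) = begin
  scRun (2 * suc (length π)) (suc (length π)) (x ∷ π) [] []
    -- The first entry goes onto the empty stack in one step, since `scRun-spec` starts from a
    -- non-empty stack.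
    ≡⟨ cong (λ f → scRun f (suc (length π)) (x ∷ π) [] []) (lemma (length π)) ⟩
  scRun (suc (2 * length π)) (suc (length π)) π (x ∷ []) []
    ≡⟨ scRun-spec π x [] [] _ _ refl (cong suc (sym (+-identityʳ _))) refl ⟩
  output false (x ∷ π) ++ []
    ≡⟨ ++-identityʳ _ ⟩
  output false (x ∷ π) ∎
  where
  open ≡-Reasoning
  lemma : ∀ a → 2 * suc a ≡ suc (suc (2 * a))
  lemma = solve-∀

-- Avoidance of 231 in a word cut at its maximum

infix 4 _≼_ _≪_

_≼_ : List ℕ → List ℕ → Set
X ≼ Y = ∀ {x y} → x ∈ X → y ∈ Y → x ≤ y

_≪_ : List ℕ → ℕ → Set
X ≪ m = ∀ {x} → x ∈ X → x < m

avoids231From-split : ∀ {a m} X Y → a < m → Avoids231From a (X ++ m ∷ Y) →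
  Avoids231From a X × All (a ≤_) Y
avoids231From-split []      Y a<m (p , _) = tt , p a<m
avoids231From-split (x ∷ X) Y a<m (p , q) with avoids231From-split X Y a<m q
... | q₁ , q₂ = (++⁻ˡ X ∘ p , q₁) , q₂

avoids231From-least : ∀ {a} Y → All (a ≤_) Y → Avoids231From a Y
avoids231From-least []      _        = tt
avoids231From-least (y ∷ Y) (_ ∷ a≤) = (λ _ → a≤) , avoids231From-least Y a≤

avoids231From-greatest : ∀ {m} Y → Y ≪ m → Avoids231From m Y
avoids231From-greatest []      _   = tt
avoids231From-greatest (y ∷ Y) Y≪m =
  (λ m<y → ⊥-elim (<-asym m<y (Y≪m (here refl)))) , avoids231From-greatest Y (Y≪m ∘ there)

avoids231From-join : ∀ {a m} X Y → a < m → Avoids231From a X → All (a ≤_) Y →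
  Avoids231From a (X ++ m ∷ Y)
avoids231From-join []      Y a<m _       a≤Y = (λ _ → a≤Y) , avoids231From-least Y a≤Y
avoids231From-join (x ∷ X) Y a<m (p , q) a≤Y =
  (λ a<x → ++⁺ (p a<x) (<⇒≤ a<m ∷ a≤Y)) , avoids231From-join X Y a<m q a≤Y

-- With `m` as the 3, a larger entry of `X` and a smaller one of `Y` would complete the pattern,
-- whence `X ≼ Y`.
avoids231-split : ∀ {m} X Y → X ≪ m → Avoids231 (X ++ m ∷ Y) →
  Avoids231 X × Avoids231 Y × X ≼ Y
avoids231-split []      Y _   (_ , q) = tt , q , λ ()
avoids231-split (x ∷ X) Y X≪m (p , q)
  with avoids231From-split X Y (X≪m (here refl)) p | avoids231-split X Y (X≪m ∘ there) q
... | p₁ , p₂ | q₁ , q₂ , q₃ = (p₁ , q₁) , q₂ , λ where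
  (here refl) y∈ → All.lookup p₂ y∈
  (there x∈)  y∈ → q₃ x∈ y∈

-- The maximum `m` can be neither the 2 nor the 1 of a pattern. A pattern with its 2 in `X` and its
-- 1 in `Y` contradicts `X ≼ Y`; any other lies within `X` or within `Y`.
avoids231-join : ∀ {m} X Y → X ≪ m → Y ≪ m → Avoids231 X → Avoids231 Y → X ≼ Y →
  Avoids231 (X ++ m ∷ Y)
avoids231-join []      Y _   Y≪m _       q X≼Y = avoids231From-greatest Y Y≪m , q
avoids231-join (x ∷ X) Y X≪m Y≪m (p , r) q X≼Y =
  avoids231From-join X Y (X≪m (here refl)) p (All.tabulate (X≼Y (here refl))) ,
  avoids231-join X Y (X≪m ∘ there) Y≪m r q (X≼Y ∘ there)

-- Double descents and output of a word cut at its maximum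

≤⇒<ᵇ≡false : ∀ {m n} → n ≤ m → (m <ᵇ n) ≡ false
≤⇒<ᵇ≡false {m} {n} n≤m with m <ᵇ n in eq
... | false = refl
... | true  = ⊥-elim (<⇒≱ (<ᵇ⇒<′ m n eq) n≤m)

-- Lets bounds and comparisons pass between a word and its output.
output-↭ : ∀ c w → output c w ↭ w
output-↭ c []      = ↭-refl
output-↭ c (x ∷ []) = ↭-refl
output-↭ c (x ∷ y ∷ r)
  with doubleDescents (y <ᵇ x) (y ∷ r) | others (y <ᵇ x) (y ∷ r)
     | output-↭ (y <ᵇ x) (y ∷ r) | c ∧ (y <ᵇ x)
... | D | R | D++R↭ | true  = prep x D++R↭
... | D | R | D++R↭ | false = begin
  D ++ reverse (x ∷ R)    ≡⟨ cong (D ++_) (unfold-reverse x R) ⟩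
  D ++ reverse R ++ [ x ] ≡⟨ ++-assoc D (reverse R) [ x ] ⟨
  (D ++ reverse R) ++ [ x ] ↭⟨ shift x (D ++ reverse R) [] ⟩
  x ∷ (D ++ reverse R) ++ [] ≡⟨ cong (x ∷_) (++-identityʳ _) ⟩
  x ∷ D ++ reverse R      ↭⟨ prep x D++R↭ ⟩
  x ∷ y ∷ r               ∎
  where open PermutationReasoning

consIf-++ : ∀ b x u v → consIf b x u ++ v ≡ consIf b x (u ++ v)
consIf-++ true  x u v = refl
consIf-++ false x u v = refl

doubleDescents-max∷ : ∀ m B → B ≪ m → doubleDescents false (m ∷ B) ≡ doubleDescents true B
doubleDescents-max∷ m []      _ = refl
doubleDescents-max∷ m (b ∷ B) B≪m rewrite <⇒<ᵇ≡true (B≪m (here refl)) = refl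

others-max∷ : ∀ m B → B ≪ m → others false (m ∷ B) ≡ m ∷ others true B
others-max∷ m []      _ = refl
others-max∷ m (b ∷ B) B≪m rewrite <⇒<ᵇ≡true (B≪m (here refl)) = refl

≪⇒∧-<ᵇ≡false : ∀ c {a m} → a < m → c ∧ (m <ᵇ a) ≡ false
≪⇒∧-<ᵇ≡false true  a<m = ≤⇒<ᵇ≡false (<⇒≤ a<m)
≪⇒∧-<ᵇ≡false false a<m = refl

-- The entry before `m` is followed by an ascent, so it is no double descent, just as at the end of
-- a word. That ascent also prevents `m` from being one, and `B` is then preceded by the larger `m`.
-- The left part is non-empty because otherwise the flag `c` could turn `m` into a double descent.
doubleDescents-++ : ∀ c a A m B → (a ∷ A) ≪ m → B ≪ m →
  doubleDescents c (a ∷ A ++ m ∷ B) ≡ doubleDescents c (a ∷ A) ++ doubleDescents true B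
doubleDescents-++ c a [] m B A≪m B≪m
  rewrite ≪⇒∧-<ᵇ≡false c (A≪m (here refl)) | ≤⇒<ᵇ≡false (<⇒≤ (A≪m (here refl)))
  = doubleDescents-max∷ m B B≪m
doubleDescents-++ c a (a′ ∷ A) m B A≪m B≪m
  rewrite doubleDescents-++ (a′ <ᵇ a) a′ A m B (A≪m ∘ there) B≪m
  = sym (consIf-++ (c ∧ (a′ <ᵇ a)) a _ _)

others-++ : ∀ c a A m B → (a ∷ A) ≪ m → B ≪ m →
  others c (a ∷ A ++ m ∷ B) ≡ others c (a ∷ A) ++ m ∷ others true B
others-++ c a [] m B A≪m B≪m
  rewrite ≪⇒∧-<ᵇ≡false c (A≪m (here refl)) | ≤⇒<ᵇ≡false (<⇒≤ (A≪m (here refl)))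
  = cong (a ∷_) (others-max∷ m B B≪m)
others-++ c a (a′ ∷ A) m B A≪m B≪m
  rewrite others-++ (a′ <ᵇ a) a′ A m B (A≪m ∘ there) B≪m
  = sym (consIf-++ (not (c ∧ (a′ <ᵇ a))) a _ _)

-- Follow the descents from `x`: the first entry that is not a double descent is at most `x`.
others-head : ∀ c x w → ∃ λ y → y ∈ others c (x ∷ w) × y ≤ x
others-head c x [] = x , here refl , ≤-refl
others-head c x (y ∷ w) with c ∧ (y <ᵇ x) in eq
... | false = x , here refl , ≤-refl
... | true with others-head (y <ᵇ x) y w
...   | z , z∈ , z≤y = z , z∈ , ≤-trans z≤y (<⇒≤ (<ᵇ⇒<′ y x (∧-conicalʳ c _ eq)))

doubleDescent-above-other : ∀ c w {x} → x ∈ doubleDescents c w →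
  ∃ λ y → y ∈ others c w × y < x
doubleDescent-above-other c (x ∷ y ∷ w) x∈
  with doubleDescent-above-other (y <ᵇ x) (y ∷ w) | c ∧ (y <ᵇ x) in eq
doubleDescent-above-other c (x ∷ y ∷ w) (here refl) | _ | true with others-head (y <ᵇ x) y w
... | z , z∈ , z≤y = z , z∈ , ≤-<-trans z≤y (<ᵇ⇒<′ y x (∧-conicalʳ c _ eq))
doubleDescent-above-other c (x ∷ y ∷ w) (there x∈) | rec | true = rec x∈
doubleDescent-above-other c (x ∷ y ∷ w) x∈ | rec | false with rec x∈
... | z , z∈ , z<x = z , there z∈ , z<x

-- The descending run through a double descent ends in a smaller entry of `others`, which `≼`
-- forbids. This is what forces the left part of a sortable word to have no double descents.
≼others⇒no-doubleDescents : ∀ c w → doubleDescents c w ≼ others c w → doubleDescents c w ≡ []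
≼others⇒no-doubleDescents c w D≼R
  with doubleDescents c w in eq | doubleDescent-above-other c w
... | []    | _ = refl
... | x ∷ _ | above with above (here refl)
...   | y , y∈ , y<x = ⊥-elim (<⇒≱ y<x (D≼R (here refl) y∈))

no-doubleDescents⇒others≡ : ∀ c w → doubleDescents c w ≡ [] → others c w ≡ w
no-doubleDescents⇒others≡ c [] _ = refl
no-doubleDescents⇒others≡ c (x ∷ []) _ = refl
no-doubleDescents⇒others≡ c (x ∷ y ∷ w) eq
  with no-doubleDescents⇒others≡ (y <ᵇ x) (y ∷ w) | c ∧ (y <ᵇ x)
... | rec | false = cong (x ∷_) (rec eq)

-- Whether a maximum with i entries before it and j after it is a double descent.
descendsThrough : Bool → ℕ → ℕ → Bool
descendsThrough true zero (suc _) = true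
descendsThrough _    _    _       = false

no-doubleDescents-join⁻ : ∀ c A m B → A ≪ m → B ≪ m → doubleDescents c (A ++ m ∷ B) ≡ [] →
  descendsThrough c (length A) (length B) ≡ false × doubleDescents c A ≡ [] × doubleDescents true B ≡ []
no-doubleDescents-join⁻ true  [] m []      _   B≪m eq = refl , refl , refl
no-doubleDescents-join⁻ true  [] m (b ∷ B) _   B≪m eq rewrite <⇒<ᵇ≡true (B≪m (here refl)) with () ← eq
no-doubleDescents-join⁻ false [] m B       _   B≪m eq =
  refl , refl , trans (sym (doubleDescents-max∷ m B B≪m)) eq
no-doubleDescents-join⁻ c (a ∷ A) m B A≪m B≪m eq =
  not-first c , ++-conicalˡ _ _ eq′ , ++-conicalʳ (doubleDescents c (a ∷ A)) _ eq′
  where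
  eq′ = trans (sym (doubleDescents-++ c a A m B A≪m B≪m)) eq
  not-first : ∀ c → descendsThrough c (suc (length A)) (length B) ≡ false
  not-first true  = refl
  not-first false = refl

no-doubleDescents-join⁺ : ∀ c A m B → A ≪ m → B ≪ m →
  descendsThrough c (length A) (length B) ≡ false →
  doubleDescents c A ≡ [] → doubleDescents true B ≡ [] →
  doubleDescents c (A ++ m ∷ B) ≡ []
no-doubleDescents-join⁺ true  [] m []      _ _ _  _ _ = refl
no-doubleDescents-join⁺ true  [] m (_ ∷ _) _ _ () _ _
no-doubleDescents-join⁺ false [] m B _ B≪m _ _ eq = trans (doubleDescents-max∷ m B B≪m) eq
no-doubleDescents-join⁺ c (a ∷ A) m B A≪m B≪m _ eq₁ eq₂ =
  trans (doubleDescents-++ c a A m B A≪m B≪m) (cong₂ _++_ eq₁ eq₂)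

reverse-join : ∀ (A : List ℕ) m B → reverse (A ++ m ∷ B) ≡ reverse B ++ m ∷ reverse A
reverse-join A m B = begin
  reverse (A ++ m ∷ B)            ≡⟨ reverse-++ A (m ∷ B) ⟩
  reverse (m ∷ B) ++ reverse A    ≡⟨ cong (_++ reverse A) (unfold-reverse m B) ⟩
  (reverse B ++ [ m ]) ++ reverse A ≡⟨ ++-assoc (reverse B) [ m ] _ ⟩
  reverse B ++ m ∷ reverse A      ∎
  where open ≡-Reasoning

parts-join : ∀ c A m B → A ≪ m → B ≪ m → descendsThrough c (length A) (length B) ≡ false →
  doubleDescents c (A ++ m ∷ B) ≡ doubleDescents c A ++ doubleDescents true B ×
  others c (A ++ m ∷ B) ≡ others c A ++ m ∷ others true B
parts-join c     (a ∷ A) m B  A≪m B≪m _ =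
  doubleDescents-++ c a A m B A≪m B≪m , others-++ c a A m B A≪m B≪m
parts-join false []      m B  _   B≪m _ = doubleDescents-max∷ m B B≪m , others-max∷ m B B≪m
parts-join true  []      m [] _   _   _ = refl , refl

-- Reversal carries the others of `B` in front of `m` and those of `A` behind it. Thus `m` again
-- cuts the output, in the shape required by `avoids231-split` and `avoids231-join`.
output-join : ∀ c A m B → A ≪ m → B ≪ m → descendsThrough c (length A) (length B) ≡ false →
  output c (A ++ m ∷ B) ≡ (doubleDescents c A ++ output true B) ++ m ∷ reverse (others c A)
output-join c A m B A≪m B≪m eq = begin
  doubleDescents c (A ++ m ∷ B) ++ reverse (others c (A ++ m ∷ B))
    ≡⟨ cong₂ (λ d r → d ++ reverse r) (proj₁ parts) (proj₂ parts) ⟩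
  (doubleDescents c A ++ doubleDescents true B) ++ reverse (others c A ++ m ∷ others true B)
    ≡⟨ cong ((doubleDescents c A ++ doubleDescents true B) ++_) (reverse-join (others c A) m _) ⟩
  (doubleDescents c A ++ doubleDescents true B) ++ reverse (others true B) ++ m ∷ reverse (others c A)
    ≡⟨ ++-assoc (doubleDescents c A ++ doubleDescents true B) (reverse (others true B)) _ ⟨
  ((doubleDescents c A ++ doubleDescents true B) ++ reverse (others true B)) ++ m ∷ reverse (others c A)
    ≡⟨ cong (_++ (m ∷ reverse (others c A))) (++-assoc (doubleDescents c A) (doubleDescents true B) _) ⟩
  (doubleDescents c A ++ output true B) ++ m ∷ reverse (others c A) ∎
  where
  open ≡-Reasoning
  parts = parts-join c A m B A≪m B≪m eq

output-join-descent : ∀ m b B → (b ∷ B) ≪ m → output true (m ∷ b ∷ B) ≡ m ∷ output true (b ∷ B)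
output-join-descent m b B B≪m rewrite <⇒<ᵇ≡true (B≪m (here refl)) = refl

reverse-∈ : ∀ {x} (w : List ℕ) → x ∈ w → x ∈ reverse w
reverse-∈ w = ∈-resp-↭ (↭-sym (↭-reverse w))

∈-reverse : ∀ {x} (w : List ℕ) → x ∈ reverse w → x ∈ w
∈-reverse w = ∈-resp-↭ (↭-reverse w)

-- If the maximum is itself a double descent, then `A` is empty and `m` heads the output. Otherwise
-- `m` cuts the output, and avoidance puts the double descents of `A` weakly below its others; hence
-- there are none and `others c A` is `A`. Both cases end in the same four conditions.
avoids231-output-join⁻ : ∀ c A m B → A ≪ m → B ≪ m → Avoids231 (output c (A ++ m ∷ B)) →
  doubleDescents c A ≡ [] × Avoids231 (reverse A) × Avoids231 (output true B) × B ≼ A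
avoids231-output-join⁻ c A m B A≪m B≪m av with descendsThrough c (length A) (length B) in eq
avoids231-output-join⁻ true [] m (b ∷ B) A≪m B≪m av | true
  rewrite output-join-descent m b B B≪m = refl , tt , proj₂ av , λ _ ()
... | false rewrite output-join c A m B A≪m B≪m eq
  with avoids231-split (doubleDescents c A ++ output true B) (reverse (others c A)) X≪m av
  where
  X≪m : (doubleDescents c A ++ output true B) ≪ m
  X≪m x∈ with ∈-++⁻ (doubleDescents c A) x∈
  ... | inj₁ x∈D = A≪m (∈-resp-↭ (output-↭ c A) (∈-++⁺ˡ x∈D))
  ... | inj₂ x∈O = B≪m (∈-resp-↭ (output-↭ true B) x∈O)
... | av₁ , av₂ , X≼Y
  with ≼others⇒no-doubleDescents c A (λ x∈ y∈ → X≼Y (∈-++⁺ˡ x∈) (reverse-∈ (others c A) y∈))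
... | D≡[] rewrite D≡[] | no-doubleDescents⇒others≡ c A D≡[] =
  refl , av₂ , av₁ , λ x∈ y∈ → X≼Y (∈-resp-↭ (↭-sym (output-↭ true B)) x∈) (reverse-∈ A y∈)

avoids231-output-join⁺ : ∀ c A m B → A ≪ m → B ≪ m →
  doubleDescents c A ≡ [] → Avoids231 (reverse A) → Avoids231 (output true B) → B ≼ A →
  Avoids231 (output c (A ++ m ∷ B))
avoids231-output-join⁺ c A m B A≪m B≪m D≡[] avA avB B≼A
  with descendsThrough c (length A) (length B) in eq
-- Here `m` heads the output and, being greater than all that follows, starts no 231.
avoids231-output-join⁺ true [] m (b ∷ B) A≪m B≪m D≡[] avA avB B≼A | true
  rewrite output-join-descent m b B B≪m =
  avoids231From-greatest _ (B≪m ∘ ∈-resp-↭ (output-↭ true (b ∷ B))) , avB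
... | false rewrite output-join c A m B A≪m B≪m eq | D≡[] | no-doubleDescents⇒others≡ c A D≡[] =
  avoids231-join (output true B) (reverse A)
    (B≪m ∘ ∈-resp-↭ (output-↭ true B)) (A≪m ∘ ∈-reverse A) avB avA
    (λ x∈ y∈ → B≼A (∈-resp-↭ (output-↭ true B) x∈) (∈-reverse A y∈))

avoids231-reverse-join⁻ : ∀ A m B → B ≪ m → Avoids231 (reverse (A ++ m ∷ B)) →
  Avoids231 (reverse A) × Avoids231 (reverse B) × B ≼ A
avoids231-reverse-join⁻ A m B B≪m av rewrite reverse-join A m B
  with avoids231-split (reverse B) (reverse A) (B≪m ∘ ∈-reverse B) av
... | avB , avA , B≼A = avA , avB , λ x∈ y∈ → B≼A (reverse-∈ B x∈) (reverse-∈ A y∈)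

avoids231-reverse-join⁺ : ∀ A m B → A ≪ m → B ≪ m →
  Avoids231 (reverse A) → Avoids231 (reverse B) → B ≼ A → Avoids231 (reverse (A ++ m ∷ B))
avoids231-reverse-join⁺ A m B A≪m B≪m avA avB B≼A rewrite reverse-join A m B =
  avoids231-join (reverse B) (reverse A) (B≪m ∘ ∈-reverse B) (A≪m ∘ ∈-reverse A) avB avA
    (λ x∈ y∈ → B≼A (∈-reverse B x∈) (∈-reverse A y∈))

-- Words on intervals of values

interval : ℕ → ℕ → List ℕ
interval lo zero    = []
-- The order is descending so that the maximum is the head and removing it leaves `interval lo k`.
interval lo (suc k) = lo + suc k ∷ interval lo k

length-interval : ∀ lo k → length (interval lo k) ≡ k
length-interval lo zero    = refl
length-interval lo (suc k) = cong suc (length-interval lo k)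

∈-interval⇒≤ : ∀ {x} lo k → x ∈ interval lo k → x ≤ lo + k
∈-interval⇒≤ lo (suc k) (here refl) = ≤-refl
∈-interval⇒≤ lo (suc k) (there x∈)  = ≤-trans (∈-interval⇒≤ lo k x∈) (+-monoʳ-≤ lo (n≤1+n k))

∈-interval⇒> : ∀ {x} lo k → x ∈ interval lo k → lo < x
∈-interval⇒> lo (suc k) (here refl) = m<m+n lo (s≤s z≤n)
∈-interval⇒> lo (suc k) (there x∈)  = ∈-interval⇒> lo k x∈

interval-≪ : ∀ lo k → interval lo k ≪ (lo + suc k)
interval-≪ lo k x∈ = ≤-<-trans (∈-interval⇒≤ lo k x∈) (+-monoʳ-< lo (n<1+n k))

interval-≼ : ∀ lo i j → interval lo j ≼ interval (lo + j) i
interval-≼ lo i j x∈ y∈ = ≤-trans (∈-interval⇒≤ lo j x∈) (<⇒≤ (∈-interval⇒> (lo + j) i y∈))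

+-shift : ∀ lo i j → lo + j + suc i ≡ lo + suc (i + j)
+-shift = solve-∀

interval-++ : ∀ lo i j → interval (lo + j) i ++ interval lo j ≡ interval lo (i + j)
interval-++ lo zero    j = refl
interval-++ lo (suc i) j = cong₂ _∷_ (+-shift lo i j) (interval-++ lo i j)

join-↭ : ∀ lo i j {A B} → A ↭ interval (lo + j) i → B ↭ interval lo j →
  A ++ (lo + suc (i + j)) ∷ B ↭ interval lo (suc (i + j))
join-↭ lo i j {A} {B} A↭ B↭ = begin
  A ++ (lo + suc (i + j)) ∷ B                 ↭⟨ shift _ A B ⟩
  lo + suc (i + j) ∷ A ++ B                   ↭⟨ prep _ (↭-++⁺ A↭ B↭) ⟩
  lo + suc (i + j) ∷ interval (lo + j) i ++ interval lo j
    ≡⟨ cong (lo + suc (i + j) ∷_) (interval-++ lo i j) ⟩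
  interval lo (suc (i + j))                   ∎
  where open PermutationReasoning

remove-∈ : ∀ {x : ℕ} {w v} → w ↭ x ∷ v → ∃₂ λ A B → w ≡ A ++ x ∷ B × A ++ B ↭ v
remove-∈ w↭ with ∈-∃++ (∈-resp-↭ (↭-sym w↭) (here refl))
... | A , B , refl = A , B , refl , drop-mid A [] w↭

-- Induction on `k`: a non-empty `A` contains the maximum, which `split-interval-at-max` removes.
-- Thus the lengths of the two parts fix their sets of values, which is what makes the enumeration
-- recursive.
split-interval : ∀ lo k A B → B ≼ A → A ++ B ↭ interval lo k →
  A ↭ interval (lo + length B) (length A) × B ↭ interval lo (length B)

split-interval-at-max : ∀ lo k A₁ A₂ B → B ≼ A₁ ++ (lo + suc k) ∷ A₂ →
  (A₁ ++ (lo + suc k) ∷ A₂) ++ B ↭ interval lo (suc k) →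
  A₁ ++ (lo + suc k) ∷ A₂ ↭ interval (lo + length B) (length (A₁ ++ (lo + suc k) ∷ A₂)) ×
  B ↭ interval lo (length B)

split-interval lo k [] B B≼A B↭ =
  ↭-refl , subst (λ k → B ↭ interval lo k) (sym (trans (↭-length B↭) (length-interval lo k))) B↭
split-interval lo zero (a ∷ A) B B≼A A++B↭ with () ← ↭-empty-inv A++B↭
split-interval lo (suc k) (a ∷ A) B B≼A A++B↭ with ∈-∃++ max∈A
  where
  max∈A : lo + suc k ∈ a ∷ A
  max∈A with ∈-++⁻ (a ∷ A) (∈-resp-↭ (↭-sym A++B↭) (here refl))
  ... | inj₁ m∈ = m∈
  -- Should the maximum occur in `B`, then `B ≼ A` bounds it by `a`, so `a` equals it.
  ... | inj₂ m∈ = here (≤-antisym (B≼A m∈ (here refl))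
                                  (∈-interval⇒≤ lo (suc k) (∈-resp-↭ A++B↭ (here refl))))
... | A₁ , A₂ , eq = subst
  (λ A → A ↭ interval (lo + length B) (length A) × B ↭ interval lo (length B)) (sym eq)
  (split-interval-at-max lo k A₁ A₂ B
    (λ x∈ y∈ → B≼A x∈ (subst (_ ∈_) (sym eq) y∈))
    (subst (λ A → A ++ B ↭ interval lo (suc k)) eq A++B↭))

split-interval-at-max lo k A₁ A₂ B B≼A A++B↭
  with split-interval lo k (A₁ ++ A₂) B
    (λ x∈ y∈ → B≼A x∈ (∈-resp-↭ (↭-sym (shift _ A₁ A₂)) (there y∈)))
    (↭-trans (↭-reflexive (++-assoc A₁ A₂ B))
      (drop-mid A₁ [] (↭-trans (↭-reflexive (sym (++-assoc A₁ (_ ∷ A₂) B))) A++B↭)))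
... | A↭ , B↭ = (begin
  A₁ ++ (lo + suc k) ∷ A₂
    ↭⟨ shift _ A₁ A₂ ⟩
  (lo + suc k) ∷ A₁ ++ A₂
    ↭⟨ prep _ A↭ ⟩
  (lo + suc k) ∷ interval (lo + j) i
    ≡⟨ cong (λ k → lo + suc k ∷ interval (lo + j) i) k≡ ⟨
  lo + suc (i + j) ∷ interval (lo + j) i
    ≡⟨ cong (_∷ interval (lo + j) i) (+-shift lo i j) ⟨
  interval (lo + j) (suc i)
    ≡⟨ cong (interval (lo + j)) length≡ ⟨
  interval (lo + j) (length (A₁ ++ (lo + suc k) ∷ A₂)) ∎) , B↭
  where
  open PermutationReasoning
  i = length (A₁ ++ A₂)
  j = length B
  length≡ : length (A₁ ++ (lo + suc k) ∷ A₂) ≡ suc i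
  length≡ = ↭-length (shift (lo + suc k) A₁ A₂)
  -- Comparing lengths shows that the removed value `lo + suc k` is the head of
  -- `interval (lo + j) (suc i)`.
  k≡ : i + j ≡ k
  k≡ = suc-injective (trans (cong (_+ j) (sym length≡))
    (trans (sym (length-++ (A₁ ++ (lo + suc k) ∷ A₂)))
      (trans (↭-length A++B↭) (length-interval lo (suc k)))))

-- Repetition-free lists assembled along antidiagonals

antidiagonal : ∀ {X : Set} → (ℕ → ℕ → List X) → ℕ → List X
antidiagonal F zero    = F 0 0
antidiagonal F (suc k) = F 0 (suc k) ++ antidiagonal (F ∘ suc) k

∈-antidiagonal⁺ : ∀ {X : Set} {x : X} F i j → x ∈ F i j → x ∈ antidiagonal F (i + j)
∈-antidiagonal⁺ F zero    zero    x∈ = x∈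
∈-antidiagonal⁺ F zero    (suc j) x∈ = ∈-++⁺ˡ x∈
∈-antidiagonal⁺ F (suc i) j       x∈ = ∈-++⁺ʳ (F 0 (suc (i + j))) (∈-antidiagonal⁺ (F ∘ suc) i j x∈)

∈-antidiagonal⁻ : ∀ {X : Set} {x : X} F k → x ∈ antidiagonal F k →
  ∃₂ λ i j → i + j ≡ k × x ∈ F i j
∈-antidiagonal⁻ F zero    x∈ = 0 , 0 , refl , x∈
∈-antidiagonal⁻ F (suc k) x∈ with ∈-++⁻ (F 0 (suc k)) x∈
... | inj₁ x∈F = 0 , suc k , refl , x∈F
... | inj₂ x∈  with ∈-antidiagonal⁻ (F ∘ suc) k x∈
...   | i , j , refl , x∈F = suc i , j , refl , x∈F

-- On one antidiagonal `i` determines the block, so disjointness of the blocks can be expressed by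
-- `i ≡ i′`.
antidiagonal-unique : ∀ {X : Set} (F : ℕ → ℕ → List X) k →
  (∀ i j → i + j ≡ k → Unique (F i j)) →
  (∀ {i j i′ j′ x} → i + j ≡ k → i′ + j′ ≡ k → x ∈ F i j → x ∈ F i′ j′ → i ≡ i′) →
  Unique (antidiagonal F k)
antidiagonal-unique F zero    uF disj = uF 0 0 refl
antidiagonal-unique F (suc k) uF disj = unique-++⁺ (uF 0 (suc k) refl)
  (antidiagonal-unique (F ∘ suc) k (λ i j eq → uF (suc i) j (cong suc eq))
    (λ eq eq′ x∈ x∈′ → suc-injective (disj (cong suc eq) (cong suc eq′) x∈ x∈′)))
  λ (x∈₀ , x∈) → case x∈₀ (∈-antidiagonal⁻ (F ∘ suc) k x∈)
  where
  case : ∀ {x} → x ∈ F 0 (suc k) → (∃₂ λ i j → i + j ≡ k × x ∈ F (suc i) j) → ⊥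
  case x∈₀ (i , j , eq , x∈) with () ← disj refl (cong suc eq) x∈₀ x∈

-- The first occurrence of `m` marks the end of the left part.
join-injectiveˡ : ∀ {m : ℕ} A A′ {B B′} → m ∉ A → m ∉ A′ → A ++ m ∷ B ≡ A′ ++ m ∷ B′ → A ≡ A′
join-injectiveˡ []      []       _   _    _  = refl
join-injectiveˡ []      (_ ∷ _)  _   m∉A′ eq = ⊥-elim (m∉A′ (here (∷-injectiveˡ eq)))
join-injectiveˡ (_ ∷ _) []       m∉A _    eq = ⊥-elim (m∉A (here (sym (∷-injectiveˡ eq))))
join-injectiveˡ (_ ∷ A) (_ ∷ A′) m∉A m∉A′ eq =
  cong₂ _∷_ (∷-injectiveˡ eq) (join-injectiveˡ A A′ (m∉A ∘ there) (m∉A′ ∘ there) (∷-injectiveʳ eq))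

joins : ℕ → List (List ℕ) → List (List ℕ) → List (List ℕ)
joins m = cartesianProductWith (λ A B → A ++ m ∷ B)

joins-unique : ∀ m {As Bs} → (∀ {A} → A ∈ As → m ∉ A) → Unique As → Unique Bs → Unique (joins m As Bs)
joins-unique m {[]} _ _ _ = []
joins-unique m {A ∷ As} {Bs} m∉ uA∷As@(_ ∷ uAs) uBs = unique-++⁺
  (map⁺ (λ eq → ∷-injectiveʳ (++-cancelˡ A _ _ eq)) uBs)
  (joins-unique m (m∉ ∘ there) uAs uBs)
  disjoint
  where
  disjoint : ∀ {w} → ¬ (w ∈ map (λ B → A ++ m ∷ B) Bs × w ∈ joins m As Bs)
  disjoint (w∈ , w∈′) with ∈-map⁻ _ w∈ | ∈-cartesianProductWith⁻ _ As Bs w∈′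
  ... | B , _ , refl | A′ , B′ , A′∈ , _ , eq
    with refl ← join-injectiveˡ A A′ (m∉ (here refl)) (m∉ (there A′∈)) eq
    = Unique[x∷xs]⇒x∉xs uA∷As A′∈

-- Recursive listing of the descentless and the sortable words

unless : ∀ {X : Set} → Bool → List X → List X
unless true  _  = []
unless false xs = xs

-- The first argument bounds the recursion depth; any depth ≥ k gives all words.
descentless : ℕ → Bool → ℕ → ℕ → List (List ℕ)
descentless f       c lo zero    = [ [] ]
descentless zero    c lo (suc k) = []
descentless (suc f) c lo (suc k) = antidiagonal (λ i j → unless (descendsThrough c i j)
  (joins (lo + suc k) (descentless f c (lo + j) i) (descentless f true lo j))) k

-- A maximum that is a double descent merely moves to the front of the output, so no block is
-- removed here, unlike in `descentless`. The left part takes the upper values, as `B ≼ A` demands.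
sortables : ℕ → Bool → ℕ → ℕ → List (List ℕ)
sortables f       c lo zero    = [ [] ]
sortables zero    c lo (suc k) = []
sortables (suc f) c lo (suc k) = antidiagonal (λ i j →
  joins (lo + suc k) (descentless f c (lo + j) i) (sortables f true lo j)) k

Descentless : Bool → ℕ → ℕ → List ℕ → Set
Descentless c lo k w = w ↭ interval lo k × doubleDescents c w ≡ [] × Avoids231 (reverse w)

Sortable : Bool → ℕ → ℕ → List ℕ → Set
Sortable c lo k w = w ↭ interval lo k × Avoids231 (output c w)

interval-length : ∀ {w} lo k → w ↭ interval lo k → length w ≡ k
interval-length lo k w↭ = trans (↭-length w↭) (length-interval lo k)

≪-below : ∀ {A} lo i j → A ↭ interval (lo + j) i → A ≪ (lo + suc (i + j))
≪-below lo i j A↭ {x} x∈ = subst (x <_) (+-shift lo i j) (interval-≪ (lo + j) i (∈-resp-↭ A↭ x∈))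

≪-right : ∀ {B} lo i j → B ↭ interval lo j → B ≪ (lo + suc (i + j))
≪-right lo i j B↭ x∈ = <-≤-trans (interval-≪ lo j (∈-resp-↭ B↭ x∈)) (+-monoʳ-≤ lo (s≤s (m≤n+m j i)))

≼-intervals : ∀ {A B} lo i j → A ↭ interval (lo + j) i → B ↭ interval lo j → B ≼ A
≼-intervals lo i j A↭ B↭ x∈ y∈ = interval-≼ lo i j (∈-resp-↭ B↭ x∈) (∈-resp-↭ A↭ y∈)

∈-unless⁻ : ∀ {X : Set} {x : X} b {xs} → x ∈ unless b xs → b ≡ false × x ∈ xs
∈-unless⁻ false x∈ = refl , x∈

∈-unless⁺ : ∀ {X : Set} {x : X} {b xs} → b ≡ false → x ∈ xs → x ∈ unless b xs
∈-unless⁺ refl x∈ = x∈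

∈-descentless⇒Descentless : ∀ f c lo k {w} → w ∈ descentless f c lo k → Descentless c lo k w
∈-descentless⇒Descentless f c lo zero (here refl) = ↭-refl , refl , tt
∈-descentless⇒Descentless (suc f) c lo (suc k) w∈ with ∈-antidiagonal⁻ _ k w∈
... | i , j , refl , w∈′ with ∈-unless⁻ (descendsThrough c i j) w∈′
... | not-through , w∈″
  with ∈-cartesianProductWith⁻ _ (descentless f c (lo + j) i) (descentless f true lo j) w∈″
... | A , B , A∈ , B∈ , refl
  with ∈-descentless⇒Descentless f c (lo + j) i A∈ | ∈-descentless⇒Descentless f true lo j B∈
... | A↭ , dA , avA | B↭ , dB , avB =
  join-↭ lo i j A↭ B↭ ,
  no-doubleDescents-join⁺ c A _ B A≪m B≪m not-through′ dA dB ,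
  avoids231-reverse-join⁺ A _ B A≪m B≪m avA avB (≼-intervals lo i j A↭ B↭)
  where
  A≪m : A ≪ (lo + suc (i + j))
  A≪m = ≪-below lo i j A↭
  B≪m : B ≪ (lo + suc (i + j))
  B≪m = ≪-right lo i j B↭
  not-through′ : descendsThrough c (length A) (length B) ≡ false
  not-through′ = trans
    (cong₂ (descendsThrough c) (interval-length (lo + j) i A↭) (interval-length lo j B↭))
    not-through

∈-sortables⇒Sortable : ∀ f c lo k {w} → w ∈ sortables f c lo k → Sortable c lo k w
∈-sortables⇒Sortable f c lo zero (here refl) = ↭-refl , tt
∈-sortables⇒Sortable (suc f) c lo (suc k) w∈ with ∈-antidiagonal⁻ _ k w∈
... | i , j , refl , w∈′
  with ∈-cartesianProductWith⁻ _ (descentless f c (lo + j) i) (sortables f true lo j) w∈′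
... | A , B , A∈ , B∈ , refl
  with ∈-descentless⇒Descentless f c (lo + j) i A∈ | ∈-sortables⇒Sortable f true lo j B∈
... | A↭ , dA , avA | B↭ , avB =
  join-↭ lo i j A↭ B↭ ,
  avoids231-output-join⁺ c A _ B (≪-below lo i j A↭) (≪-right lo i j B↭)
    dA avA avB (≼-intervals lo i j A↭ B↭)

split-max : ∀ lo k {w} → w ↭ interval lo (suc k) →
  ∃₂ λ A B → w ≡ A ++ (lo + suc k) ∷ B × A ++ B ↭ interval lo k ×
    A ≪ (lo + suc k) × B ≪ (lo + suc k) × length A + length B ≡ k
split-max lo k w↭ with remove-∈ w↭
... | A , B , eq , A++B↭ = A , B , eq , A++B↭ ,
  (λ x∈ → interval-≪ lo k (∈-resp-↭ A++B↭ (∈-++⁺ˡ x∈))) ,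
  (λ x∈ → interval-≪ lo k (∈-resp-↭ A++B↭ (∈-++⁺ʳ A x∈))) ,
  trans (sym (length-++ A)) (interval-length lo k A++B↭)

-- Removing the maximum leaves two parts, neither longer than the recursion depth that remains.
Descentless⇒∈-descentless : ∀ f c lo k {w} → k ≤ f → Descentless c lo k w → w ∈ descentless f c lo k
Descentless⇒∈-descentless f c lo zero _ (w↭ , _) rewrite ↭-empty-inv w↭ = here refl
Descentless⇒∈-descentless (suc f) c lo (suc k) (s≤s k≤f) (w↭ , d , av) with split-max lo k w↭
... | A , B , refl , A++B↭ , A≪m , B≪m , refl
  with no-doubleDescents-join⁻ c A _ B A≪m B≪m d | avoids231-reverse-join⁻ A _ B B≪m av
... | not-through , dA , dB | avA , avB , B≼A with split-interval lo _ A B B≼A A++B↭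
... | A↭ , B↭ = ∈-antidiagonal⁺ _ (length A) (length B)
  (∈-unless⁺ not-through (∈-cartesianProductWith⁺ (λ A B → A ++ _ ∷ B)
    (Descentless⇒∈-descentless f c (lo + length B) (length A) (≤-trans (m≤m+n _ _) k≤f) (A↭ , dA , avA))
    (Descentless⇒∈-descentless f true lo (length B) (≤-trans (m≤n+m _ _) k≤f) (B↭ , dB , avB))))

Sortable⇒∈-sortables : ∀ f c lo k {w} → k ≤ f → Sortable c lo k w → w ∈ sortables f c lo k
Sortable⇒∈-sortables f c lo zero _ (w↭ , _) rewrite ↭-empty-inv w↭ = here refl
Sortable⇒∈-sortables (suc f) c lo (suc k) (s≤s k≤f) (w↭ , av) with split-max lo k w↭
... | A , B , refl , A++B↭ , A≪m , B≪m , refl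
  with avoids231-output-join⁻ c A _ B A≪m B≪m av
... | dA , avA , avB , B≼A with split-interval lo _ A B B≼A A++B↭
... | A↭ , B↭ = ∈-antidiagonal⁺ _ (length A) (length B) (∈-cartesianProductWith⁺ (λ A B → A ++ _ ∷ B)
    (Descentless⇒∈-descentless f c (lo + length B) (length A) (≤-trans (m≤m+n _ _) k≤f) (A↭ , dA , avA))
    (Sortable⇒∈-sortables f true lo (length B) (≤-trans (m≤n+m _ _) k≤f) (B↭ , avB)))

≪⇒∉ : ∀ {A m} → A ≪ m → m ∉ A
≪⇒∉ A≪m m∈ = <-irrefl refl (A≪m m∈)

descentless-∌max : ∀ f c lo i j {A} → A ∈ descentless f c (lo + j) i → lo + suc (i + j) ∉ A
descentless-∌max f c lo i j A∈ =
  ≪⇒∉ (≪-below lo i j (proj₁ (∈-descentless⇒Descentless f c (lo + j) i A∈)))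

-- By `join-injectiveˡ` the word determines its left part, whose length is `i`.
joins-disjoint : ∀ f c lo k {i j i′ j′ w Bs Bs′} → i + j ≡ k → i′ + j′ ≡ k →
  w ∈ joins (lo + suc k) (descentless f c (lo + j) i) Bs →
  w ∈ joins (lo + suc k) (descentless f c (lo + j′) i′) Bs′ → i ≡ i′
joins-disjoint f c lo k {i} {j} {i′} {j′} eq eq′ w∈ w∈′
  with ∈-cartesianProductWith⁻ _ (descentless f c (lo + j) i) _ w∈
     | ∈-cartesianProductWith⁻ _ (descentless f c (lo + j′) i′) _ w∈′
... | A , _ , A∈ , _ , refl | A′ , _ , A′∈ , _ , w≡
  with refl ← join-injectiveˡ A A′
    (subst (λ k → lo + suc k ∉ A) eq (descentless-∌max f c lo i j A∈))
    (subst (λ k → lo + suc k ∉ A′) eq′ (descentless-∌max f c lo i′ j′ A′∈)) w≡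
  = trans (sym (interval-length (lo + j) i (proj₁ (∈-descentless⇒Descentless f c (lo + j) i A∈))))
          (interval-length (lo + j′) i′ (proj₁ (∈-descentless⇒Descentless f c (lo + j′) i′ A′∈)))

unless-unique : ∀ {X : Set} b {xs : List X} → Unique xs → Unique (unless b xs)
unless-unique true  _ = []
unless-unique false u = u

descentless-unique : ∀ f c lo k → Unique (descentless f c lo k)
descentless-unique f       c lo zero    = [] ∷ []
descentless-unique zero    c lo (suc k) = []
descentless-unique (suc f) c lo (suc k) = antidiagonal-unique _ k
  (λ { i j refl → unless-unique (descendsThrough c i j) (joins-unique _ (descentless-∌max f c lo i j)
    (descentless-unique f c (lo + j) i) (descentless-unique f true lo j)) })
  (λ {i} {j} {i′} {j′} eq eq′ w∈ w∈′ → joins-disjoint f c lo k eq eq′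
    (proj₂ (∈-unless⁻ (descendsThrough c i j) w∈)) (proj₂ (∈-unless⁻ (descendsThrough c i′ j′) w∈′)))

sortables-unique : ∀ f c lo k → Unique (sortables f c lo k)
sortables-unique f       c lo zero    = [] ∷ []
sortables-unique zero    c lo (suc k) = []
sortables-unique (suc f) c lo (suc k) = antidiagonal-unique _ k
  (λ { i j refl → joins-unique _ (descentless-∌max f c lo i j)
    (descentless-unique f c (lo + j) i) (sortables-unique f true lo j) })
  (joins-disjoint f c lo k)

-- Permutations generated by insertion

∈-insertions⁺ : ∀ x A B → A ++ x ∷ B ∈ insertions x (A ++ B)
∈-insertions⁺ x []      []      = here refl
∈-insertions⁺ x []      (b ∷ B) = here refl
∈-insertions⁺ x (a ∷ A) B       = there (∈-map⁺ (a ∷_) (∈-insertions⁺ x A B))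

∈-insertions⁻ : ∀ x ys {zs} → zs ∈ insertions x ys → ∃₂ λ A B → ys ≡ A ++ B × zs ≡ A ++ x ∷ B
∈-insertions⁻ x []       (here refl) = [] , [] , refl , refl
∈-insertions⁻ x (y ∷ ys) (here refl) = [] , y ∷ ys , refl , refl
∈-insertions⁻ x (y ∷ ys) (there zs∈) with ∈-map⁻ (y ∷_) zs∈
... | _ , zs′∈ , refl with ∈-insertions⁻ x ys zs′∈
... | A , B , refl , refl = y ∷ A , B , refl , refl

∈-concatMap-∷⁻ : ∀ x yss {zs} → zs ∈ concatMap (insertions x) yss →
  ∃ λ ys → ys ∈ yss × zs ∈ insertions x ys
∈-concatMap-∷⁻ x (ys ∷ yss) zs∈ with ∈-++⁻ (insertions x ys) zs∈
... | inj₁ zs∈ys  = ys , here refl , zs∈ys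
... | inj₂ zs∈yss with ∈-concatMap-∷⁻ x yss zs∈yss
...   | ys′ , ys′∈ , zs∈ys′ = ys′ , there ys′∈ , zs∈ys′

∈-concatMap-∷⁺ : ∀ x {ys yss zs} → ys ∈ yss → zs ∈ insertions x ys → zs ∈ concatMap (insertions x) yss
∈-concatMap-∷⁺ x (here refl)              zs∈ = ∈-++⁺ˡ zs∈
∈-concatMap-∷⁺ x {yss = ys ∷ _} (there ys∈) zs∈ = ∈-++⁺ʳ (insertions x ys) (∈-concatMap-∷⁺ x ys∈ zs∈)

∈-perms⇒↭ : ∀ xs {π} → π ∈ perms xs → π ↭ xs
∈-perms⇒↭ []       (here refl) = ↭-refl
∈-perms⇒↭ (x ∷ xs) π∈ with ∈-concatMap-∷⁻ x (perms xs) π∈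
... | ys , ys∈ , π∈ys with ∈-insertions⁻ x ys π∈ys
... | A , B , refl , refl = ↭-trans (shift x A B) (prep x (∈-perms⇒↭ xs ys∈))

↭⇒∈-perms : ∀ xs {π} → π ↭ xs → π ∈ perms xs
↭⇒∈-perms []       π↭ rewrite ↭-empty-inv π↭ = here refl
↭⇒∈-perms (x ∷ xs) π↭ with remove-∈ π↭
... | A , B , refl , A++B↭ = ∈-concatMap-∷⁺ x (↭⇒∈-perms xs A++B↭) (∈-insertions⁺ x A B)

insertions-unique : ∀ x ys → x ∉ ys → Unique (insertions x ys)
insertions-unique x []       _   = [] ∷ []
insertions-unique x (y ∷ ys) x∉ =
  All.tabulate (λ w∈ eq → head≢ (∈-map⁻ (y ∷_) w∈) eq) ∷
  map⁺ ∷-injectiveʳ (insertions-unique x ys (x∉ ∘ there))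
  where
  head≢ : ∀ {w} → (∃ λ v → v ∈ insertions x ys × w ≡ y ∷ v) → x ∷ y ∷ ys ≢ w
  head≢ (_ , _ , refl) eq = x∉ (here (∷-injectiveˡ eq))

-- Deleting `x` from an insertion recovers `ys`, so different `ys` give disjoint blocks.
concatMap-insertions-unique : ∀ x yss → (∀ {ys} → ys ∈ yss → x ∉ ys) → Unique yss →
  Unique (concatMap (insertions x) yss)
concatMap-insertions-unique x []         _  _ = []
concatMap-insertions-unique x (ys ∷ yss) x∉ u@(_ ∷ uyss) = unique-++⁺
  (insertions-unique x ys (x∉ (here refl)))
  (concatMap-insertions-unique x yss (x∉ ∘ there) uyss)
  disjoint
  where
  disjoint : ∀ {w} → ¬ (w ∈ insertions x ys × w ∈ concatMap (insertions x) yss)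
  disjoint (w∈ , w∈′) with ∈-concatMap-∷⁻ x yss w∈′
  ... | ys′ , ys′∈ , w∈ys′ with ∈-insertions⁻ x ys w∈ | ∈-insertions⁻ x ys′ w∈ys′
  ... | A , B , refl , refl | A′ , B′ , refl , eq
    with refl ← join-injectiveˡ A A′ (x∉ (here refl) ∘ ∈-++⁺ˡ) (x∉ (there ys′∈) ∘ ∈-++⁺ˡ) eq
    with refl ← ∷-injectiveʳ (++-cancelˡ A _ _ eq)
    = Unique[x∷xs]⇒x∉xs u ys′∈

perms-unique : ∀ xs → Unique xs → Unique (perms xs)
perms-unique []       _           = [] ∷ []
perms-unique (x ∷ xs) u@(_ ∷ uxs) = concatMap-insertions-unique x (perms xs)
  (λ ys∈ x∈ → Unique[x∷xs]⇒x∉xs u (∈-resp-↭ (∈-perms⇒↭ xs ys∈) x∈))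
  (perms-unique xs uxs)

S-unique : ∀ n → Unique (S n)
S-unique n = perms-unique _ (map⁺ suc-injective (upTo⁺ n))

applyDownFrom-suc : ∀ n → applyDownFrom suc n ≡ interval 0 n
applyDownFrom-suc zero    = refl
applyDownFrom-suc (suc n) = cong (suc n ∷_) (applyDownFrom-suc n)

map-suc-upTo-↭ : ∀ n → map suc (upTo n) ↭ interval 0 n
map-suc-upTo-↭ n = begin
  map suc (upTo n)        ≡⟨ map-upTo suc n ⟩
  applyUpTo suc n         ↭⟨ ↭-reverse (applyUpTo suc n) ⟨
  reverse (applyUpTo suc n) ≡⟨ reverse-applyUpTo suc n ⟩
  applyDownFrom suc n     ≡⟨ applyDownFrom-suc n ⟩
  interval 0 n            ∎
  where open PermutationReasoning

-- Convolutions and the Motzkin recurrence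

antidiagonalSum : (ℕ → ℕ → ℕ) → ℕ → ℕ
antidiagonalSum F zero    = F 0 0
antidiagonalSum F (suc k) = F 0 (suc k) + antidiagonalSum (F ∘ suc) k

antidiagonalSum-cong : ∀ {F G} k → (∀ i j → i + j ≡ k → F i j ≡ G i j) →
  antidiagonalSum F k ≡ antidiagonalSum G k
antidiagonalSum-cong zero    F≡G = F≡G 0 0 refl
antidiagonalSum-cong (suc k) F≡G = cong₂ _+_ (F≡G 0 (suc k) refl)
  (antidiagonalSum-cong k (λ i j eq → F≡G (suc i) j (cong suc eq)))

antidiagonalSum-last : ∀ F k →
  antidiagonalSum F (suc k) ≡ antidiagonalSum (λ i j → F i (suc j)) k + F (suc k) 0
antidiagonalSum-last F zero    = refl
antidiagonalSum-last F (suc k) = trans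
  (cong (F 0 (suc (suc k)) +_) (antidiagonalSum-last (F ∘ suc) k))
  (sym (+-assoc (F 0 (suc (suc k))) _ _))

antidiagonalSum-flip : ∀ F k → antidiagonalSum F k ≡ antidiagonalSum (λ i j → F j i) k
antidiagonalSum-flip F zero    = refl
antidiagonalSum-flip F (suc k) = begin
  F 0 (suc k) + antidiagonalSum (F ∘ suc) k ≡⟨ +-comm (F 0 (suc k)) _ ⟩
  antidiagonalSum (F ∘ suc) k + F 0 (suc k) ≡⟨ cong (_+ F 0 (suc k)) (antidiagonalSum-flip (F ∘ suc) k) ⟩
  antidiagonalSum (λ i j → F (suc j) i) k + F 0 (suc k) ≡⟨ antidiagonalSum-last (λ i j → F j i) k ⟨
  antidiagonalSum (λ i j → F j i) (suc k) ∎
  where open ≡-Reasoning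

length-antidiagonal : ∀ {X : Set} (F : ℕ → ℕ → List X) k →
  length (antidiagonal F k) ≡ antidiagonalSum (λ i j → length (F i j)) k
length-antidiagonal F zero    = refl
length-antidiagonal F (suc k) = trans (length-++ (F 0 (suc k)))
  (cong (length (F 0 (suc k)) +_) (length-antidiagonal (F ∘ suc) k))

length-joins : ∀ m As Bs → length (joins m As Bs) ≡ length As * length Bs
length-joins m []       Bs = refl
length-joins m (A ∷ As) Bs = trans (length-++ (map (λ B → A ++ m ∷ B) Bs))
  (cong₂ _+_ (length-map _ Bs) (length-joins m As Bs))

-- One list runs downwards and the other upwards, so paired indices add up to `n`.
sum-zipWith-* : ∀ (f g : ℕ → ℕ) n →
  sum (zipWith _*_ (applyDownFrom f (suc n)) (applyUpTo g (suc n))) ≡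
  antidiagonalSum (λ i j → g i * f j) n
sum-zipWith-* f g zero    = trans (+-identityʳ _) (*-comm (f 0) (g 0))
sum-zipWith-* f g (suc n) = cong₂ _+_ (*-comm (f (suc n)) (g 0)) (sum-zipWith-* f (g ∘ suc) n)

-- The `with` in `M` reduces only once the head of `motzkinsRev n` is exposed, hence the equation as
-- a hypothesis.
motzkinsRev⇒M : ∀ n {m ms} → motzkinsRev n ≡ m ∷ ms → M n ≡ m
motzkinsRev⇒M n eq rewrite eq = refl

motzkinsRev-step : ∀ n {m ms} → motzkinsRev (suc n) ≡ m ∷ ms →
  motzkinsRev (suc (suc n)) ≡ (m + sum (zipWith _*_ ms (reverse ms))) ∷ m ∷ ms
motzkinsRev-step n eq rewrite eq = refl

motzkinsRev≡ : ∀ n → motzkinsRev n ≡ applyDownFrom M (suc n)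
motzkinsRev≡ zero          = refl
motzkinsRev≡ (suc zero)    = refl
motzkinsRev≡ (suc (suc n)) with motzkinsRev-step n (motzkinsRev≡ (suc n))
... | step = trans step
  (cong (_∷ applyDownFrom M (suc (suc n))) (sym (motzkinsRev⇒M (suc (suc n)) step)))

M-recurrence : ∀ n → M (suc (suc n)) ≡ M (suc n) + antidiagonalSum (λ i j → M i * M j) n
M-recurrence n = begin
  M (suc (suc n))
    ≡⟨ motzkinsRev⇒M (suc (suc n)) (motzkinsRev-step n (motzkinsRev≡ (suc n))) ⟩
  M (suc n) + sum (zipWith _*_ ms (reverse ms))
    ≡⟨ cong (λ l → M (suc n) + sum (zipWith _*_ ms l)) (reverse-applyDownFrom M (suc n)) ⟩
  M (suc n) + sum (zipWith _*_ ms (applyUpTo M (suc n)))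
    ≡⟨ cong (M (suc n) +_) (sum-zipWith-* M M n) ⟩
  M (suc n) + antidiagonalSum (λ i j → M i * M j) n ∎
  where
  open ≡-Reasoning
  ms = applyDownFrom M (suc n)

-- Counting the listed words

descentlessCount : Bool → ℕ → ℕ
descentlessCount false k       = M k
descentlessCount true  zero    = 1
descentlessCount true  (suc k) = M k

-- The term `i = 0` contributes `M k`, and the shift in `descentlessCount true` turns the remaining
-- terms into the convolution of the Motzkin recurrence.
M-convolution : ∀ k → antidiagonalSum (λ i j → descentlessCount true i * M j) k ≡ M (suc k)
M-convolution zero    = refl
M-convolution (suc k) = trans (cong (_+ antidiagonalSum (λ i j → M i * M j) k) (+-identityʳ (M (suc k))))
  (sym (M-recurrence k))

M-convolution′ : ∀ k → antidiagonalSum (λ i j → M i * descentlessCount true j) k ≡ M (suc k)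
M-convolution′ k = begin
  antidiagonalSum (λ i j → M i * descentlessCount true j) k ≡⟨ antidiagonalSum-flip _ k ⟩
  antidiagonalSum (λ i j → M j * descentlessCount true i) k
    ≡⟨ antidiagonalSum-cong k (λ i j _ → *-comm (M j) (descentlessCount true i)) ⟩
  antidiagonalSum (λ i j → descentlessCount true i * M j) k ≡⟨ M-convolution k ⟩
  M (suc k) ∎
  where open ≡-Reasoning

-- For `c = true` and `k > 0` the term with the maximum in front vanishes, and shifting `i` by one
-- changes the left factor into `M`, so `M-convolution′` applies as it does for `c = false`. For
-- `k = 0` the lone maximum has no successor, so its term stays.
descentlessCount-suc : ∀ c k →
  antidiagonalSum (λ i j → if descendsThrough c i j then 0
    else descentlessCount c i * descentlessCount true j) k ≡
  descentlessCount c (suc k)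
descentlessCount-suc false k       = M-convolution′ k
descentlessCount-suc true  zero    = refl
descentlessCount-suc true  (suc k) = M-convolution′ k

length-unless : ∀ {X : Set} b (xs : List X) → length (unless b xs) ≡ (if b then 0 else length xs)
length-unless true  xs = refl
length-unless false xs = refl

length-descentless : ∀ f c lo k → k ≤ f → length (descentless f c lo k) ≡ descentlessCount c k
length-descentless f       false lo zero    _         = refl
length-descentless f       true  lo zero    _         = refl
length-descentless (suc f) c     lo (suc k) (s≤s k≤f) = begin
  length (descentless (suc f) c lo (suc k))
    ≡⟨ length-antidiagonal _ k ⟩
  antidiagonalSum (λ i j → length (unless (descendsThrough c i j) (words i j))) k
    ≡⟨ antidiagonalSum-cong k (λ i j eq → trans (length-unless (descendsThrough c i j) (words i j))
         (cong (if descendsThrough c i j then 0 else_) (length-words i j eq))) ⟩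
  antidiagonalSum (λ i j → if descendsThrough c i j then 0
    else descentlessCount c i * descentlessCount true j) k
    ≡⟨ descentlessCount-suc c k ⟩
  descentlessCount c (suc k) ∎
  where
  open ≡-Reasoning
  words : ℕ → ℕ → List (List ℕ)
  words i j = joins (lo + suc k) (descentless f c (lo + j) i) (descentless f true lo j)
  length-words : ∀ i j → i + j ≡ k → length (words i j) ≡ descentlessCount c i * descentlessCount true j
  length-words i j refl = trans
    (length-joins _ (descentless f c (lo + j) i) (descentless f true lo j)) (cong₂ _*_
    (length-descentless f c (lo + j) i (≤-trans (m≤m+n i j) k≤f))
    (length-descentless f true lo j (≤-trans (m≤n+m j i) k≤f)))

length-sortables : ∀ f lo k → k ≤ f → length (sortables f true lo k) ≡ M k

-- The right part follows the maximum, so it carries the flag `true` and is counted by `M`; only the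
-- left factor depends on `c`. The case `c = true` closes the recursion with `length-sortables`, and
-- `c = false` counts the sortable permutations.
length-sortables-suc : ∀ f c lo k → k ≤ f → length (sortables (suc f) c lo (suc k)) ≡
  antidiagonalSum (λ i j → descentlessCount c i * M j) k
length-sortables-suc f c lo k k≤f = trans (length-antidiagonal _ k) (antidiagonalSum-cong k length-words)
  where
  length-words : ∀ i j → i + j ≡ k →
    length (joins (lo + suc k) (descentless f c (lo + j) i) (sortables f true lo j)) ≡
    descentlessCount c i * M j
  length-words i j refl = trans
    (length-joins _ (descentless f c (lo + j) i) (sortables f true lo j)) (cong₂ _*_
    (length-descentless f c (lo + j) i (≤-trans (m≤m+n i j) k≤f))
    (length-sortables f lo j (≤-trans (m≤n+m j i) k≤f)))

length-sortables f       lo zero    _         = refl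
length-sortables (suc f) lo (suc k) (s≤s k≤f) =
  trans (length-sortables-suc f true lo k k≤f) (M-convolution k)

-- Identifying the sortable permutations with the listed words

T-not-contains231-SC123⇔ : ∀ π → T (not (contains231 (SC123 π))) ⇔ Avoids231 (output false π)
T-not-contains231-SC123⇔ π rewrite SC123≡output π = contains231≡false⇔ (output false π) ⇔-∘ T-not-≡

∈-Sort⇔∈-sortables : ∀ n {π} → π ∈ Sort n ⇔ π ∈ sortables n false 0 n
∈-Sort⇔∈-sortables n {π} = mk⇔ to from
  where
  open Equivalence (T-not-contains231-SC123⇔ π) renaming (to to avoids; from to sorts)
  P? = λ π → T? (not (contains231 (SC123 π)))
  to : π ∈ Sort n → π ∈ sortables n false 0 n
  to π∈ with ∈-filter⁻ P? {xs = S n} π∈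
  ... | π∈S , sorted = Sortable⇒∈-sortables n false 0 n ≤-refl
    (↭-trans (∈-perms⇒↭ _ π∈S) (map-suc-upTo-↭ n) , avoids sorted)
  from : π ∈ sortables n false 0 n → π ∈ Sort n
  from π∈ with ∈-sortables⇒Sortable n false 0 n π∈
  ... | π↭ , av = ∈-filter⁺ P? (↭⇒∈-perms _ (↭-trans π↭ (↭-sym (map-suc-upTo-↭ n)))) (sorts av)

theorem6p8 : (n : ℕ) → 1 ≤ n → length (Sort n) ≡ M (suc n) ∸ M n
theorem6p8 (suc k) _ = begin
  length (Sort (suc k))
    -- Two repetition-free lists with the same members are permutations of each other, so their
    -- lengths agree.
    ≡⟨ ↭-length (∼bag⇒↭ (unique∧set⇒bag
         (filter⁺ (λ π → T? (not (contains231 (SC123 π)))) (S-unique (suc k)))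
         (sortables-unique (suc k) false 0 (suc k))
         (∈-Sort⇔∈-sortables (suc k)))) ⟩
  length (sortables (suc k) false 0 (suc k))
    ≡⟨ length-sortables-suc k false 0 k ≤-refl ⟩
  antidiagonalSum (λ i j → M i * M j) k
    -- Adding and removing `M (suc k)` produces the right side of the Motzkin recurrence, so the
    -- truncated subtraction is the true difference.
    ≡⟨ m+n∸m≡n (M (suc k)) _ ⟨
  M (suc k) + antidiagonalSum (λ i j → M i * M j) k ∸ M (suc k)
    ≡⟨ cong (_∸ M (suc k)) (M-recurrence k) ⟨
  M (suc (suc k)) ∸ M (suc k) ∎
  where open ≡-Reasoning
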